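{- Let $\mathcal{C}$ be a covering of a finite set $U$ with $|U|=m$, such that there are no two distinct elements $u,v\in U$ with $\mathcal{C}(\{u\})=\mathcal{C}(\{v\})$ and $|\mathcal{C}(\{u\})|=1$. Let $V$ be an $n$-dimensional vector space over the finite field $\mathbb{F}_q$, and let $L(V)$ be the lattice of subspaces of $V$ ordered by inclusion. If $L(\mathcal{C})\cong L(V)$, then $n\leq 2$. In the case $n=2$, we must have $m=q+1$ and $k=1$, where $k:=|\mathcal{E}|$.
   Context: A covering of a finite set $U$ is a collection $\mathcal{C}\subseteq 2^U$ of subsets of $U$ whose union is $U$. For $H\subseteq U$, $\mathcal{C}(H):=\{C\in\mathcal{C} : C\cap H\neq\emptyset\}$. The matroid $M(\mathcal{C})$ is the transversal matroid of $\mathcal{C}$ on the ground set $U$: its independent sets are the partial transversals of $\mathcal{C}$, i.e. the sets $I\subseteq U$ for which there is an injective map $\varphi:I\to\mathcal{C}$ with $e\in\varphi(e)$ for all $e\in I$. $L(\mathcal{C})$ is the lattice of closed sets (flats) of $M(\mathcal{C})$ ordered by inclusion. For $x\in U$ with $|\mathcal{C}(\{x\})|=2$, $E(\{x\}):=\{y\in U : \mathcal{C}(\{y\})\subseteq\mathcal{C}(\{x\})\}$, and $\mathcal{E}:=\{E(\{x\}) : x\in U,\ |\mathcal{C}(\{x\})|=2\}$. -}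

module Defs where

open import Level using (Level; _⊔_; suc; 0ℓ)
open import Data.Bool.Properties using () renaming (_≟_ to _≟ᵇ_)
open import Data.Fin using (Fin)
open import Data.Fin.Subset as Subset using (Subset; ⊤; ⁅_⁆; _∩_; _∪_; ∣_∣; ⋃)
open import Data.Fin.Subset.Properties using (nonempty?)
import Data.Fin.Subset.Properties as Subsetₚ
open import Data.List using (List; length; filter; map; deduplicate; allFin)
open import Data.List.Membership.Propositional using (_∈_)
open import Data.List.Relation.Unary.Unique.Propositional using (Unique)
open import Data.Nat using (ℕ; _≤_; _≟_)
open import Data.Product using (Σ-syntax; ∃; ∃-syntax; _×_; proj₁)
open import Data.Vec using (tabulate)
open import Data.Vec.Functional using (Vector)
import Data.Vec.Properties as Vecₚ
open import Function using (_⇔_; Inverse)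
open import Relation.Binary using (Poset; DecidableEquality)
import Relation.Binary.Construct.On as On
open import Relation.Binary.Morphism.Structures using (IsOrderIsomorphism)
open import Relation.Binary.PropositionalEquality using (_≡_; setoid)
open import Relation.Nullary using (does)
open import Relation.Unary using (Pred; Decidable)
import Relation.Unary as Unary
import Relation.Unary.Relation.Binary.Subset as Unary⊆
open import Algebra.Apartness.Bundles using (HeytingField; HeytingCommutativeRing)
open import Algebra.Bundles using (CommutativeRing)
open import Algebra.Module.Bundles using (Module)
import Algebra.Properties.Monoid.Sum as MonoidSum

_≟ˢ_ : ∀ {m} → DecidableEquality (Subset m)
_≟ˢ_ = Vecₚ.≡-dec _≟ᵇ_

module _ {m : ℕ} where
  open import Data.List.Relation.Binary.Subset.DecPropositional (_≟ˢ_ {m}) public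
    using () renaming (_⊆_ to _⊆ᶜ_; _⊆?_ to _⊆ᶜ?_)

-- Ground set U = Fin m.  A finite set of subsets of U is a duplicate-free
-- list, so that `length` is its cardinality; the order of the list plays no
-- role.  The empty set is allowed as a member.

record Covering (m : ℕ) : Set where
  field
    members : List (Subset m)
    unique  : Unique members
    covers  : ⋃ members ≡ ⊤

module _ {m : ℕ} (𝒞 : Covering m) where
  open Covering 𝒞

  meeting : Subset m → List (Subset m)
  meeting H = filter (λ C → nonempty? (C ∩ H)) members

  at : Fin m → List (Subset m)
  at x = meeting ⁅ x ⁆

  SameAt : Fin m → Fin m → Set
  SameAt u v = at u ⊆ᶜ at v × at v ⊆ᶜ at u

  E : Fin m → Subset m
  E x = tabulate (λ y → does (at y ⊆ᶜ? at x))

  ℰ : List (Subset m)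
  ℰ = deduplicate _≟ˢ_ (map E (filter (λ x → length (at x) ≟ 2) (allFin m)))

  PartialTransversal : Pred (Subset m) 0ℓ
  PartialTransversal I =
    Σ[ φ ∈ (∀ e → e Subset.∈ I → Subset m) ]
      (∀ e (p : e Subset.∈ I) → φ e p ∈ members × e Subset.∈ φ e p) ×
      (∀ e f (p : e Subset.∈ I) (r : f Subset.∈ I) → φ e p ≡ φ f r → e ≡ f)

-- Rank, closure and flats of the matroid with independent sets `Indep`.

module _ {m : ℕ} {ℓ : Level} (Indep : Pred (Subset m) ℓ) where

  -- r is the maximal size of an independent subset of X.
  IsRank : Subset m → ℕ → Set ℓ
  IsRank X r =
    (∃[ I ] I Subset.⊆ X × Indep I × ∣ I ∣ ≡ r) ×
    (∀ I → I Subset.⊆ X → Indep I → ∣ I ∣ ≤ r)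

  Closure : Subset m → Pred (Fin m) ℓ
  Closure X e = ∃[ r ] IsRank X r × IsRank (X ∪ ⁅ e ⁆) r

  IsFlat : Pred (Subset m) ℓ
  IsFlat X = ∀ e → Closure X e ⇔ e Subset.∈ X

  FlatLattice : Poset ℓ 0ℓ 0ℓ
  FlatLattice = On.poset (Subsetₚ.⊆-poset m) (proj₁ {B = IsFlat})

L : ∀ {m} → Covering m → Poset 0ℓ 0ℓ 0ℓ
L 𝒞 = FlatLattice (PartialTransversal 𝒞)

-- The apartness of a Heyting field is "x - y is invertible".  On a carrier in
-- bijection with some Fin q it coincides with ¬ (x ≈ y), so a Heyting field
-- of order q is exactly a finite field with q elements.

module _ {c ℓ₁ ℓ₂ : Level} (F : HeytingField c ℓ₁ ℓ₂) where

  fieldRing : CommutativeRing c ℓ₁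
  fieldRing = HeytingCommutativeRing.commutativeRing (HeytingField.heytingCommutativeRing F)

  HasOrder : ℕ → Set (c ⊔ ℓ₁)
  HasOrder q = Inverse (CommutativeRing.setoid fieldRing) (setoid (Fin q))

  VectorSpace : (v ℓv : Level) → Set (c ⊔ ℓ₁ ⊔ suc (v ⊔ ℓv))
  VectorSpace v ℓv = Module fieldRing v ℓv

module _ {c ℓ₁ ℓ₂ v ℓv : Level} {F : HeytingField c ℓ₁ ℓ₂} (V : VectorSpace F v ℓv) where
  open HeytingField F using (Carrier; _≈_; 0#)
  open Module V using (Carrierᴹ; _≈ᴹ_; _+ᴹ_; _*ₗ_; 0ᴹ; +ᴹ-monoid)

  combination : ∀ {n} → Vector Carrier n → Vector Carrierᴹ n → Carrierᴹ
  combination a b = MonoidSum.sum +ᴹ-monoid (λ i → a i *ₗ b i)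

  record IsBasis {n : ℕ} (b : Vector Carrierᴹ n) : Set (c ⊔ ℓ₁ ⊔ v ⊔ ℓv) where
    field
      independent : ∀ a → combination a b ≈ᴹ 0ᴹ → ∀ i → a i ≈ 0#
      spanning    : ∀ x → ∃[ a ] combination a b ≈ᴹ x

  HasDimension : ℕ → Set (c ⊔ ℓ₁ ⊔ v ⊔ ℓv)
  HasDimension n = ∃ λ (b : Vector Carrierᴹ n) → IsBasis b

  -- Used here for finite V, where classically every subspace is decidable.
  record Subspace (p : Level) : Set (c ⊔ v ⊔ ℓv ⊔ suc p) where
    field
      carrier   : Pred Carrierᴹ p
      decidable : Decidable carrier
      resp      : ∀ {x y} → x ≈ᴹ y → carrier x → carrier y
      0-closed  : carrier 0ᴹ
      +-closed  : ∀ {x y} → carrier x → carrier y → carrier (x +ᴹ y)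
      *-closed  : ∀ a {x} → carrier x → carrier (a *ₗ x)

  -- Ordered by inclusion; two subspaces are equal when they include each other.
  SubspaceLattice : (p : Level) → Poset (c ⊔ v ⊔ ℓv ⊔ suc p) (v ⊔ p) (v ⊔ p)
  SubspaceLattice p = On.poset (Unary⊆.⊆-poset Carrierᴹ p) (Subspace.carrier {p})

-- A bijection preserving and reflecting the order; between lattices these are
-- the lattice isomorphisms.

_≅_ : ∀ {a b c d e f} → Poset a b c → Poset d e f → Set (a ⊔ b ⊔ c ⊔ d ⊔ e ⊔ f)
P ≅ Q = ∃ (IsOrderIsomorphism P._≈_ Q._≈_ P._≤_ Q._≤_)
  where
  module P = Poset P
  module Q = Poset Q

{-# OPTIONS --safe #-}
module Submission where

-- The hypothesis makes M(𝒞) simple, so each point of V (as a projective space) is a single element of U.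
-- Three collinear points are dependent, so by Hall's theorem their blocks lie in one pair {A, B}, and
-- some point t on the line has 𝒞({t}) = {A, B}: otherwise two of the three would lie in the same single
-- block and nowhere else. Every line through t then has all its blocks in {A, B}. Hence
-- {z : 𝒞({z}) ⊆ {A, B}} is a flat of rank 2 which contains every line through t, so n ≤ 2. For n = 2 this
-- flat is U, so every E({x}) is U, and m is the number q + 1 of points of the projective line.

open import Defs
open import Level using (Level; _⊔_; Lift; lift; lower)
open import Algebra.Apartness.Bundles using (HeytingField)
import Algebra.Apartness.Properties.HeytingCommutativeRing as HeytingCommutativeRingₚ
open import Algebra.Bundles using (CommutativeMonoid; CommutativeRing)
open import Algebra.Module.Bundles using (Module)
import Algebra.Properties.CommutativeMonoid.Sum as Sumₚ
import Algebra.Properties.CommutativeSemigroup as CommutativeSemigroupₚ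
import Algebra.Properties.Group as Groupₚ
import Algebra.Properties.Ring as Ringₚ
open import Data.Bool using (if_then_else_)
open import Data.Empty using (⊥; ⊥-elim)
open import Data.Fin using (Fin; zero; suc)
import Data.Fin.Properties as Finₚ
open import Data.Fin.Subset as Subset using (Subset; inside; outside; ⁅_⁆; _∪_; ∣_∣; ⋃)
import Data.Fin.Subset.Properties as Subsetₚ
open import Data.List using (List; []; _∷_; length; map; filter; deduplicate; lookup; allFin)
import Data.List.Membership.DecPropositional as DecMem
open import Data.List.Membership.Propositional using (_∈_; _∉_; find; lose)
import Data.List.Membership.Propositional.Properties as Mem
import Data.List.Properties as Listₚ
open import Data.List.Relation.Unary.All as All using (All; []; _∷_)
open import Data.List.Relation.Unary.AllPairs using ([]; _∷_)
open import Data.List.Relation.Unary.Any as Any using (here; there)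
import Data.List.Relation.Unary.Any.Properties as Anyₚ
open import Data.List.Relation.Unary.Unique.Propositional using (Unique)
import Data.List.Relation.Unary.Unique.Propositional.Properties as Uniqueₚ
open import Data.Nat as ℕ using (ℕ; suc; _+_; _≤_; z≤n; s≤s)
import Data.Nat.Properties as ℕₚ
open import Data.Product using (Σ; ∃-syntax; ∃₂; _×_; _,_; proj₁; proj₂)
open import Data.Sum using (_⊎_; inj₁; inj₂; [_,_]′)
open import Data.Vec using ([]; _∷_; here; there; tabulate)
open import Data.Vec.Functional as Vector using (Vector)
import Data.Vec.Properties as Vecₚ
open import Function using (_∘_; _⇔_; mk⇔; Equivalence; Inverse)
open import Relation.Binary.Morphism.Structures using (IsOrderIsomorphism)
open import Relation.Binary.PropositionalEquality
  using (_≡_; _≢_; refl; sym; trans; cong; subst; subst₂; ≢-sym)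
import Relation.Binary.Reasoning.Setoid as ≈-Reasoning
open import Relation.Nullary using (¬_; Dec; yes; no; ¬?; contradiction; does; _×-dec_)
open import Relation.Nullary.Decidable using (map′; True; toWitness; fromWitness; dec-true)

-- The isomorphism carries only the order, so rank is never compared with dimension. A non-zero
-- vector `u` is tied to the element `x` that lies in exactly those flats whose images contain `u`,
-- and collinearity is read in the same way: the third point lies in every flat that contains the
-- other two. Dependence therefore enters by contraposition: if the blocks of `x` and `y` fit in no
-- pair of members, then {x, y} is itself a flat and no third point can be collinear with them.
-- Three points on a line always exist, namely those of `u`, `w` and `u + w`. The point t is needed
-- because its blocks are a whole pair and not merely contained in one: any pair that serves for
-- another line through t contains the same two blocks, hence is the same pair. Case distinctions on
-- vectors and subspaces are constructive, since the finite field makes the relevant searches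
-- finite.

pattern here₀ = here refl
pattern here₁ = there (here refl)
pattern here₂ = there (there (here refl))

-- Counting with duplicate-free lists and finite subsets.

module _ {a} {A : Set a} where

  lookup-injective : ∀ {xs : List A} → Unique xs → ∀ {i j} → lookup xs i ≡ lookup xs j → i ≡ j
  lookup-injective (_ ∷ _)        {zero}  {zero}  _  = refl
  lookup-injective (x∉ ∷ _)       {zero}  {suc j} eq = ⊥-elim (All.lookup x∉ (Mem.∈-lookup j) eq)
  lookup-injective (x∉ ∷ _)       {suc i} {zero}  eq = ⊥-elim (All.lookup x∉ (Mem.∈-lookup i) (sym eq))
  lookup-injective (_ ∷ unique)   {suc i} {suc j} eq = cong suc (lookup-injective unique eq)

  index-injective : ∀ {x y : A} {zs} (p : x ∈ zs) (r : y ∈ zs) → Any.index p ≡ Any.index r → x ≡ y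
  index-injective {zs = zs} p r eq =
    trans (Anyₚ.lookup-index p) (trans (cong (lookup zs) eq) (sym (Anyₚ.lookup-index r)))

  unique-⊆-length : ∀ {xs ys : List A} → Unique xs → (∀ {x} → x ∈ xs → x ∈ ys) → length xs ≤ length ys
  unique-⊆-length unique sub = Finₚ.injective⇒≤ {f = λ i → Any.index (sub (Mem.∈-lookup i))}
    (λ eq → lookup-injective unique (index-injective (sub (Mem.∈-lookup _)) (sub (Mem.∈-lookup _)) eq))

  unique-map-injective : ∀ {b} {B : Set b} (f : A → B) {xs} → Unique (map f xs) →
                         ∀ {x y} → x ∈ xs → y ∈ xs → f x ≡ f y → x ≡ y
  unique-map-injective f _          here₀     here₀     _  = refl
  unique-map-injective f (x∉ ∷ _)   here₀     (there r) eq = ⊥-elim (All.lookup x∉ (Mem.∈-map⁺ f r) eq)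
  unique-map-injective f (x∉ ∷ _)   (there p) here₀     eq = ⊥-elim (All.lookup x∉ (Mem.∈-map⁺ f p) (sym eq))
  unique-map-injective f (_ ∷ uniq) (there p) (there r) eq = unique-map-injective f uniq p r eq

  deduplicate-constant : ∀ (_≟_ : (x y : A) → Dec (x ≡ y)) {z} xs → (∀ {x} → x ∈ xs → x ≡ z) →
                         ∀ {y} → y ∈ xs → length (deduplicate _≟_ xs) ≡ 1
  deduplicate-constant _≟_ (x ∷ xs) const _ = cong (suc ∘ length)
    (Listₚ.filter-none (λ y → ¬? (x ≟ y)) (All.tabulate λ y∈ x≢y →
      x≢y (trans (const here₀) (sym (const (there (Mem.∈-deduplicate⁻ _≟_ xs y∈)))))))

module _ {m : ℕ} where

  setOf : List (Fin m) → Subset m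
  setOf xs = ⋃ (map ⁅_⁆ xs)

  ∈-setOf⁺ : ∀ {x xs} → x ∈ xs → x Subset.∈ setOf xs
  ∈-setOf⁺ {xs = y ∷ ys} here₀      = Subsetₚ.x∈p∪q⁺ (inj₁ (Subsetₚ.x∈⁅x⁆ y))
  ∈-setOf⁺ {xs = y ∷ ys} (there x∈) = Subsetₚ.x∈p∪q⁺ {p = ⁅ y ⁆} (inj₂ (∈-setOf⁺ x∈))

  ∈-setOf⁻ : ∀ {x} xs → x Subset.∈ setOf xs → x ∈ xs
  ∈-setOf⁻ []       x∈ = ⊥-elim (Subsetₚ.∉⊥ x∈)
  ∈-setOf⁻ (y ∷ ys) x∈ with Subsetₚ.x∈p∪q⁻ ⁅ y ⁆ (setOf ys) x∈
  ... | inj₁ x∈y = here (Subsetₚ.x∈⁅y⁆⇒x≡y y x∈y)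
  ... | inj₂ x∈s = there (∈-setOf⁻ ys x∈s)

∈-tabulate⁺ : ∀ {m p} {P : Fin m → Set p} (P? : ∀ x → Dec (P x)) {x} →
              P x → x Subset.∈ tabulate (λ y → does (P? y))
∈-tabulate⁺ P? {x} px = Vecₚ.lookup⇒[]= x _ (trans (Vecₚ.lookup∘tabulate _ x) (dec-true (P? x) px))

∈-tabulate⁻ : ∀ {m p} {P : Fin m → Set p} (P? : ∀ x → Dec (P x)) {x} →
              x Subset.∈ tabulate (λ y → does (P? y)) → P x
∈-tabulate⁻ P? {x} x∈ with P? x | trans (sym (Vecₚ.lookup∘tabulate (λ y → does (P? y)) x)) (Vecₚ.[]=⇒lookup x∈)
... | yes px | _ = px

∪⁅⁆-⊆ : ∀ {m} {x : Fin m} {p} → x Subset.∈ p → p ∪ ⁅ x ⁆ Subset.⊆ p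
∪⁅⁆-⊆ {x = x} {p} x∈p y∈ with Subsetₚ.x∈p∪q⁻ p ⁅ x ⁆ y∈
... | inj₁ y∈p = y∈p
... | inj₂ y∈x with refl ← Subsetₚ.x∈⁅y⁆⇒x≡y x y∈x = x∈p

∣⁅x⁆∪p∣ : ∀ {m} {x : Fin m} {p} → x Subset.∉ p → ∣ ⁅ x ⁆ ∪ p ∣ ≡ suc ∣ p ∣
∣⁅x⁆∪p∣ {x = zero}  {outside ∷ p} x∉p = cong (suc ∘ ∣_∣) (Subsetₚ.∪-identityˡ p)
∣⁅x⁆∪p∣ {x = zero}  {inside  ∷ p} x∉p = ⊥-elim (x∉p here)
∣⁅x⁆∪p∣ {x = suc x} {outside ∷ p} x∉p = ∣⁅x⁆∪p∣ (x∉p ∘ there)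
∣⁅x⁆∪p∣ {x = suc x} {inside  ∷ p} x∉p = cong suc (∣⁅x⁆∪p∣ (x∉p ∘ there))

∣setOf∣ : ∀ {m} {xs : List (Fin m)} → Unique xs → ∣ setOf xs ∣ ≡ length xs
∣setOf∣ {m} []             = Subsetₚ.∣⊥∣≡0 m
∣setOf∣ {xs = x ∷ xs} (x∉ ∷ unique) = trans
  (∣⁅x⁆∪p∣ (λ x∈ → All.lookup x∉ (∈-setOf⁻ xs x∈) refl)) (cong suc (∣setOf∣ unique))

-- Lists the members of `p` in increasing order, so that a bound on the size of `p` can be proved by
-- an injection out of `Fin ∣ p ∣`.
element : ∀ {m} (p : Subset m) → Fin ∣ p ∣ → Fin m
element (outside ∷ p) i       = suc (element p i)
element (inside  ∷ p) zero    = zero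
element (inside  ∷ p) (suc i) = suc (element p i)

element-∈ : ∀ {m} (p : Subset m) i → element p i Subset.∈ p
element-∈ (outside ∷ p) i       = there (element-∈ p i)
element-∈ (inside  ∷ p) zero    = here
element-∈ (inside  ∷ p) (suc i) = there (element-∈ p i)

element-injective : ∀ {m} (p : Subset m) {i j} → element p i ≡ element p j → i ≡ j
element-injective (outside ∷ p)                 eq = element-injective p (Finₚ.suc-injective eq)
element-injective (inside  ∷ p) {zero}  {zero}  eq = refl
element-injective (inside  ∷ p) {suc i} {suc j} eq = cong suc (element-injective p (Finₚ.suc-injective eq))

-- Flats and ranks of M(𝒞) from explicit transversals.

module TransversalMatroid {m : ℕ} (𝒞 : Covering m) where
  open Covering 𝒞

  Flat : Set
  Flat = Σ (Subset m) (IsFlat (PartialTransversal 𝒞))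

  Rank : Subset m → ℕ → Set
  Rank = IsRank (PartialTransversal 𝒞)

  ∈-at⁺ : ∀ {C x} → C ∈ members → x Subset.∈ C → C ∈ at 𝒞 x
  ∈-at⁺ {x = x} C∈ x∈ = Mem.∈-filter⁺ _ C∈ (x , Subsetₚ.x∈p∩q⁺ (x∈ , Subsetₚ.x∈⁅x⁆ x))

  ∈-at⁻ : ∀ {C x} → C ∈ at 𝒞 x → C ∈ members × x Subset.∈ C
  ∈-at⁻ {C} {x} C∈ with Mem.∈-filter⁻ (λ D → Subsetₚ.nonempty? (D Subset.∩ ⁅ x ⁆)) {xs = members} C∈
  ... | C∈′ , y , y∈ with Subsetₚ.x∈p∩q⁻ C ⁅ x ⁆ y∈
  ... | y∈C , y∈x with refl ← Subsetₚ.x∈⁅y⁆⇒x≡y x y∈x = C∈′ , y∈C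

  at-unique : ∀ x → Unique (at 𝒞 x)
  at-unique x = Uniqueₚ.filter⁺ _ unique

  ∈-⋃⁻ : ∀ {x} (Cs : List (Subset m)) → x Subset.∈ ⋃ Cs → ∃[ C ] C ∈ Cs × x Subset.∈ C
  ∈-⋃⁻ []       x∈ = ⊥-elim (Subsetₚ.∉⊥ x∈)
  ∈-⋃⁻ (C ∷ Cs) x∈ with Subsetₚ.x∈p∪q⁻ C (⋃ Cs) x∈
  ... | inj₁ x∈C = C , here₀ , x∈C
  ... | inj₂ x∈Cs with D , D∈ , x∈D ← ∈-⋃⁻ Cs x∈Cs = D , there D∈ , x∈D

  at-nonempty : ∀ x → ∃[ C ] C ∈ at 𝒞 x
  at-nonempty x with C , C∈ , x∈ ← ∈-⋃⁻ members (subst (x Subset.∈_) (sym covers) Subsetₚ.∈⊤) =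
    C , ∈-at⁺ C∈ x∈

  -- A partial transversal as a list of matched pairs: the small matchings needed later can then be
  -- written out entry by entry, which the function form of `PartialTransversal` makes awkward.
  Transversal : List (Fin m × Subset m) → Set
  Transversal ps = Unique (map proj₁ ps) × Unique (map proj₂ ps) × All (λ (x , C) → C ∈ at 𝒞 x) ps

  transversal-independent : ∀ {ps} → Transversal ps → PartialTransversal 𝒞 (setOf (map proj₁ ps))
  transversal-independent {ps} (_ , uniqueC , ps-at) =
    (λ e p → proj₁ (rep e p)) ,
    (λ e p → ∈-at⁻ (All.lookup ps-at (proj₂ (rep e p)))) ,
    (λ e f p r eq → cong proj₁ (unique-map-injective proj₂ uniqueC (proj₂ (rep e p)) (proj₂ (rep f r)) eq))
    where
    rep : ∀ e → e Subset.∈ setOf (map proj₁ ps) → ∃[ C ] (e , C) ∈ ps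
    rep e p with (_ , C) , y∈ , refl ← Mem.∈-map⁻ proj₁ (∈-setOf⁻ _ p) = C , y∈

  transversal-≤-rank : ∀ {ps X r} → Transversal ps → (∀ {x} → x ∈ map proj₁ ps → x Subset.∈ X) →
                       Rank X r → length (map proj₁ ps) ≤ r
  transversal-≤-rank t sub (_ , bound) = subst (_≤ _) (∣setOf∣ (proj₁ t))
    (bound _ (sub ∘ ∈-setOf⁻ _) (transversal-independent t))

  -- The set is independent, so its rank is its size, and every outside element raises the rank. The
  -- extended matching `qs` may assign new blocks to the old elements.
  transversal-flat : ∀ {ps} → Transversal ps →
    (∀ z → z ∉ map proj₁ ps → ∃[ qs ] Transversal qs × map proj₁ qs ≡ z ∷ map proj₁ ps) →
    IsFlat (PartialTransversal 𝒞) (setOf (map proj₁ ps))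
  transversal-flat {ps} t extend e = mk⇔ closed closure
    where
    xs = map proj₁ ps
    X = setOf xs

    rank : ∀ Y → X Subset.⊆ Y → Y Subset.⊆ X → Rank Y (length xs)
    rank Y X⊆Y Y⊆X = (X , X⊆Y , transversal-independent t , ∣setOf∣ (proj₁ t)) ,
      λ I I⊆Y _ → subst (∣ I ∣ ≤_) (∣setOf∣ (proj₁ t)) (Subsetₚ.p⊆q⇒∣p∣≤∣q∣ (Y⊆X ∘ I⊆Y))

    closed : Closure (PartialTransversal 𝒞) X e → e Subset.∈ X
    closed (r , ((I , I⊆X , _ , ∣I∣≡r) , _) , rank-e) with e Subsetₚ.∈? X
    ... | yes e∈X = e∈X
    ... | no  e∉X with qs , t′ , eq ← extend e (e∉X ∘ ∈-setOf⁺) = contradiction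
      (subst₂ _≤_ (cong length eq) (sym ∣I∣≡r) (transversal-≤-rank t′ (sub ∘ subst (_ ∈_) eq) rank-e))
      (ℕₚ.≤⇒≯ (subst (∣ I ∣ ≤_) (∣setOf∣ (proj₁ t)) (Subsetₚ.p⊆q⇒∣p∣≤∣q∣ I⊆X)))
      where
      sub : ∀ {x} → x ∈ e ∷ xs → x Subset.∈ X ∪ ⁅ e ⁆
      sub here₀      = Subsetₚ.x∈p∪q⁺ {p = X} (inj₂ (Subsetₚ.x∈⁅x⁆ e))
      sub (there x∈) = Subsetₚ.x∈p∪q⁺ (inj₁ (∈-setOf⁺ x∈))

    closure : e Subset.∈ X → Closure (PartialTransversal 𝒞) X e
    closure e∈X = length xs , rank X (λ x∈ → x∈) (λ x∈ → x∈) ,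
      rank (X ∪ ⁅ e ⁆) (Subsetₚ.p⊆p∪q _) (∪⁅⁆-⊆ e∈X)

  -- The matching `φ` is an injection of `I` into `Cs`.
  rank-≤-reps : ∀ {I} Cs → (∀ {x} → x Subset.∈ I → at 𝒞 x ⊆ᶜ Cs) →
                PartialTransversal 𝒞 I → ∣ I ∣ ≤ length Cs
  rank-≤-reps {I} Cs sub (φ , φ-at , φ-inj) = Finₚ.injective⇒≤ {f = λ i → Any.index (rep i)}
    (λ {i} {j} eq → element-injective I
      (φ-inj _ _ (element-∈ I i) (element-∈ I j) (index-injective (rep i) (rep j) eq)))
    where
    rep : ∀ i → φ (element I i) (element-∈ I i) ∈ Cs
    rep i with C∈ , x∈ ← φ-at (element I i) (element-∈ I i) = sub (element-∈ I i) (∈-at⁺ C∈ x∈)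

  rank-of-reps : ∀ {X ps} Cs → (∀ {x} → x Subset.∈ X → at 𝒞 x ⊆ᶜ Cs) → Transversal ps →
                 (∀ {x} → x ∈ map proj₁ ps → x Subset.∈ X) → length (map proj₁ ps) ≡ length Cs →
                 Rank X (length Cs)
  rank-of-reps Cs sub t ps⊆X eq =
    (_ , ps⊆X ∘ ∈-setOf⁻ _ , transversal-independent t , trans (∣setOf∣ (proj₁ t)) eq) ,
    λ I I⊆X → rank-≤-reps Cs (sub ∘ I⊆X)

-- Points and lines of the simple matroid M(𝒞).

module SimpleCovering {m : ℕ} (𝒞 : Covering m)
  (simple : ¬ (∃[ x ] ∃[ y ] x ≢ y × SameAt 𝒞 x y × length (at 𝒞 x) ≡ 1)) where
  open Covering 𝒞
  open TransversalMatroid 𝒞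
  open DecMem (_≟ˢ_ {m}) using (_∈?_)

  other : (Cs : List (Subset m)) (C : Subset m) → (∃[ D ] D ∈ Cs × D ≢ C) ⊎ (∀ {D} → D ∈ Cs → D ≡ C)
  other Cs C with Any.any? (λ D → ¬? (D ≟ˢ C)) Cs
  ... | yes p with D , D∈ , D≢C ← find p = inj₁ (D , D∈ , D≢C)
  ... | no ¬p = inj₂ only
    where
    only : ∀ {D} → D ∈ Cs → D ≡ C
    only {D} D∈ with D ≟ˢ C
    ... | yes eq = eq
    ... | no  ne = ⊥-elim (¬p (lose D∈ ne))

  -- Hall's theorem for two elements. It can fail only if both have one and the same single block,
  -- which is what `simple` forbids; this is the one place where `simple` is applied.
  distinct-reps : ∀ {x y} → x ≢ y → ∃[ C ] ∃[ D ] C ∈ at 𝒞 x × D ∈ at 𝒞 y × C ≢ D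
  distinct-reps {x} {y} x≢y with at-nonempty x | at-nonempty y
  ... | C , C∈ | D , D∈ with C ≟ˢ D
  ... | no C≢D = C , D , C∈ , D∈ , C≢D
  ... | yes refl with other (at 𝒞 y) C | other (at 𝒞 x) C
  ... | inj₁ (D′ , D′∈ , D′≢C) | _ = C , D′ , C∈ , D′∈ , ≢-sym D′≢C
  ... | inj₂ _ | inj₁ (C′ , C′∈ , C′≢C) = C′ , C , C′∈ , D∈ , C′≢C
  ... | inj₂ only-y | inj₂ only-x = ⊥-elim (simple (x , y , x≢y ,
        ((λ E∈ → subst (_∈ at 𝒞 y) (sym (only-x E∈)) D∈) , (λ E∈ → subst (_∈ at 𝒞 x) (sym (only-y E∈)) C∈)) ,
        ℕₚ.≤-antisym (unique-⊆-length {ys = C ∷ []} (at-unique x) (λ E∈ → here (only-x E∈)))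
                     (unique-⊆-length {xs = C ∷ []} ([] ∷ []) (λ { here₀ → C∈ }))))

  transversal₁ : ∀ x → ∃[ C ] Transversal ((x , C) ∷ [])
  transversal₁ x with C , C∈ ← at-nonempty x = C , [] ∷ [] , [] ∷ [] , C∈ ∷ []

  transversal₂ : ∀ {x y} → x ≢ y → ∃₂ λ C D → Transversal ((x , C) ∷ (y , D) ∷ [])
  transversal₂ x≢y with C , D , C∈ , D∈ , C≢D ← distinct-reps x≢y =
    C , D , (x≢y ∷ []) ∷ [] ∷ [] , (C≢D ∷ []) ∷ [] ∷ [] , C∈ ∷ D∈ ∷ []

  abstract
    empty-closed : IsFlat (PartialTransversal 𝒞) (setOf [])
    empty-closed = transversal-flat {[]} ([] , [] , [])
      λ z _ → let (C , t) = transversal₁ z in _ , t , refl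

    -- Any two elements are independent by `transversal₂`, so no element is parallel to `x`.
    point-closed : ∀ x → IsFlat (PartialTransversal 𝒞) (setOf (x ∷ []))
    point-closed x = transversal-flat (proj₂ (transversal₁ x))
      λ z z∉ → let (_ , _ , t) = transversal₂ (λ { refl → z∉ here₀ }) in _ , t , refl

  empty-flat : Flat
  empty-flat = setOf [] , empty-closed

  point-flat : Fin m → Flat
  point-flat x = setOf (x ∷ []) , point-closed x

  Within : Subset m → Subset m → Fin m → Set
  Within A B x = at 𝒞 x ⊆ᶜ A ∷ B ∷ []

  within? : ∀ A B x → Dec (Within A B x)
  within? A B x = at 𝒞 x ⊆ᶜ? A ∷ B ∷ []

  outside-pair : ∀ {A B x} → ¬ Within A B x → ∃[ D ] D ∈ at 𝒞 x × D ≢ A × D ≢ B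
  outside-pair {A} {B} {x} ¬w with Any.any? (λ D → ¬? (D ∈? (A ∷ B ∷ []))) (at 𝒞 x)
  ... | yes p with D , D∈ , D∉ ← find p = D , D∈ , (λ eq → D∉ (here eq)) , (λ eq → D∉ (there (here eq)))
  ... | no ¬p = ⊥-elim (¬w sub)
    where
    sub : Within A B x
    sub {D} D∈ with D ∈? (A ∷ B ∷ [])
    ... | yes D∈AB = D∈AB
    ... | no  D∉AB = ⊥-elim (¬p (lose D∈ D∉AB))

  rank₂ : ∀ {A B x y X} → x ≢ y → (∀ {z} → z Subset.∈ X → Within A B z) →
          x Subset.∈ X → y Subset.∈ X → Rank X 2
  rank₂ {A} {B} x≢y sub x∈ y∈ with _ , _ , t ← transversal₂ x≢y =
    rank-of-reps (A ∷ B ∷ []) sub t (λ { here₀ → x∈ ; here₁ → y∈ }) refl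

  -- Two blocks bound the rank by 2 both before and after `z` is added, and `x`, `y` attain it, so
  -- `z` is in the closure.
  in-rank₂-flat : ∀ {A B x y z} (X : Flat) → x ≢ y → (∀ {z} → z Subset.∈ proj₁ X → Within A B z) →
                  x Subset.∈ proj₁ X → y Subset.∈ proj₁ X → Within A B z → z Subset.∈ proj₁ X
  in-rank₂-flat {A} {B} {z = z} (X , flat) x≢y sub x∈ y∈ z∈ = Equivalence.to (flat z)
    (2 , rank₂ x≢y sub x∈ y∈ , rank₂ x≢y sub′ (Subsetₚ.x∈p∪q⁺ (inj₁ x∈)) (Subsetₚ.x∈p∪q⁺ (inj₁ y∈)))
    where
    sub′ : ∀ {w} → w Subset.∈ X ∪ ⁅ z ⁆ → Within A B w
    sub′ w∈ with Subsetₚ.x∈p∪q⁻ X ⁅ z ⁆ w∈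
    ... | inj₁ w∈X = sub w∈X
    ... | inj₂ w∈z with refl ← Subsetₚ.x∈⁅y⁆⇒x≡y z w∈z = z∈

  pair-span : Subset m → Subset m → Subset m
  pair-span A B = tabulate (λ z → does (within? A B z))

  abstract
    -- An element outside has a block `D` other than `A` and `B`. Together with distinct blocks of
    -- `x` and `y`, this matches three elements, while two blocks allow rank 2 at most.
    pair-span-closed : ∀ {A B x y} → x ≢ y → Within A B x → Within A B y →
                       IsFlat (PartialTransversal 𝒞) (pair-span A B)
    pair-span-closed {A} {B} {x} {y} x≢y x-in y-in = λ e → mk⇔ (closed e) (closure e)
      where
      X : Subset m
      X = pair-span A B

      closed : ∀ e → Closure (PartialTransversal 𝒞) X e → e Subset.∈ X
      closed e (r , ((I , I⊆X , indep , ∣I∣≡r) , _) , rank-e) with within? A B e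
      ... | yes e-in = ∈-tabulate⁺ (within? A B) e-in
      ... | no ¬e-in with D , D∈ , D≢A , D≢B ← outside-pair ¬e-in
                        | C , C′ , C∈ , C′∈ , C≢C′ ← distinct-reps x≢y = contradiction
        (subst (3 ≤_) (sym ∣I∣≡r) (transversal-≤-rank triple sub rank-e))
        (ℕₚ.≤⇒≯ (rank-≤-reps (A ∷ B ∷ []) (λ z∈ → ∈-tabulate⁻ (within? A B) (I⊆X z∈)) indep))
        where
        D≢ : ∀ {C} → C ∈ A ∷ B ∷ [] → D ≢ C
        D≢ here₀ = D≢A
        D≢ here₁ = D≢B

        e≢ : ∀ {z} → Within A B z → e ≢ z
        e≢ z-in refl = ¬e-in z-in

        triple : Transversal ((e , D) ∷ (x , C) ∷ (y , C′) ∷ [])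
        triple = (e≢ x-in ∷ e≢ y-in ∷ []) ∷ (x≢y ∷ []) ∷ [] ∷ [] ,
                 (D≢ (x-in C∈) ∷ D≢ (y-in C′∈) ∷ []) ∷ (C≢C′ ∷ []) ∷ [] ∷ [] ,
                 D∈ ∷ C∈ ∷ C′∈ ∷ []

        sub : ∀ {z} → z ∈ e ∷ x ∷ y ∷ [] → z Subset.∈ X ∪ ⁅ e ⁆
        sub here₀ = Subsetₚ.x∈p∪q⁺ {p = X} (inj₂ (Subsetₚ.x∈⁅x⁆ e))
        sub here₁ = Subsetₚ.x∈p∪q⁺ (inj₁ (∈-tabulate⁺ (within? A B) x-in))
        sub here₂ = Subsetₚ.x∈p∪q⁺ (inj₁ (∈-tabulate⁺ (within? A B) y-in))

      closure : ∀ e → e Subset.∈ X → Closure (PartialTransversal 𝒞) X e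
      closure e e∈X = 2 ,
        rank₂ x≢y (∈-tabulate⁻ (within? A B)) (∈-tabulate⁺ (within? A B) x-in) (∈-tabulate⁺ (within? A B) y-in) ,
        rank₂ x≢y (∈-tabulate⁻ (within? A B) ∘ ∪⁅⁆-⊆ e∈X) (Subsetₚ.x∈p∪q⁺ (inj₁ (∈-tabulate⁺ (within? A B) x-in)))
          (Subsetₚ.x∈p∪q⁺ (inj₁ (∈-tabulate⁺ (within? A B) y-in)))

  pair-span-flat : ∀ {A B x y} → x ≢ y → Within A B x → Within A B y → Flat
  pair-span-flat {A} {B} x≢y x-in y-in = pair-span A B , pair-span-closed x≢y x-in y-in

  -- Hall's theorem for three elements: `spread` says that `x` and `y` together have at least three
  -- blocks, and pairs are handled by `distinct-reps`. Start from any block `C` of `z` and ask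
  -- whether `x` and `y` can avoid it.
  transversal₃ : ∀ {x y z} → x ≢ y → z ≢ x → z ≢ y →
    (∀ {A B} → A ∈ members → B ∈ members → ¬ (Within A B x × Within A B y)) →
    ∃[ C ] ∃[ A ] ∃[ B ] Transversal ((z , C) ∷ (x , A) ∷ (y , B) ∷ [])
  transversal₃ {x} {y} {z} x≢y z≢x z≢y spread with at-nonempty z
  ... | C , C∈ = by-cases (other (at 𝒞 x) C) (other (at 𝒞 y) C)
    where
    Result = ∃[ C ] ∃[ A ] ∃[ B ] Transversal ((z , C) ∷ (x , A) ∷ (y , B) ∷ [])

    triple : ∀ {C A B} → C ∈ at 𝒞 z → A ∈ at 𝒞 x → B ∈ at 𝒞 y → C ≢ A → C ≢ B → A ≢ B → Result
    triple C∈ A∈ B∈ C≢A C≢B A≢B = _ , _ , _ , (z≢x ∷ z≢y ∷ []) ∷ (x≢y ∷ []) ∷ [] ∷ [] ,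
      (C≢A ∷ C≢B ∷ []) ∷ (A≢B ∷ []) ∷ [] ∷ [] , C∈ ∷ A∈ ∷ B∈ ∷ []

    escape : ∀ {A B} → A ∈ members → B ∈ members → ∃[ D ] (D ∈ at 𝒞 x ⊎ D ∈ at 𝒞 y) × D ≢ A × D ≢ B
    escape {A} {B} A∈ B∈ with within? A B x
    ... | no ¬x-in with D , D∈ , ne ← outside-pair ¬x-in = D , inj₁ D∈ , ne
    ... | yes x-in with D , D∈ , ne ← outside-pair (λ y-in → spread A∈ B∈ (x-in , y-in)) = D , inj₂ D∈ , ne

    member : ∀ {C x} → C ∈ at 𝒞 x → C ∈ members
    member = proj₁ ∘ ∈-at⁻

    by-cases : (∃[ D ] D ∈ at 𝒞 x × D ≢ C) ⊎ (∀ {D} → D ∈ at 𝒞 x → D ≡ C) →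
               (∃[ D ] D ∈ at 𝒞 y × D ≢ C) ⊎ (∀ {D} → D ∈ at 𝒞 y → D ≡ C) → Result
    -- `x` has only the block `C`, so `z` moves to `C′`; the third block supplied by `escape` then
    -- has to be a block of `y`.
    by-cases (inj₂ only) _ with distinct-reps (≢-sym z≢x)
    ... | Cx , C′ , Cx∈ , C′∈ , Cx≢C′ with refl ← only Cx∈ | escape (member C∈) (member C′∈)
    ... | D , inj₁ D∈ , D≢C , _ = ⊥-elim (D≢C (only D∈))
    ... | D , inj₂ D∈ , D≢C , D≢C′ = triple C′∈ Cx∈ D∈ (≢-sym Cx≢C′) (≢-sym D≢C′) (≢-sym D≢C)
    by-cases (inj₁ _) (inj₂ only) with distinct-reps (≢-sym z≢y)
    ... | Cy , C′ , Cy∈ , C′∈ , Cy≢C′ with refl ← only Cy∈ | escape (member C∈) (member C′∈)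
    ... | D , inj₂ D∈ , D≢C , _ = ⊥-elim (D≢C (only D∈))
    ... | D , inj₁ D∈ , D≢C , D≢C′ = triple C′∈ D∈ Cy∈ (≢-sym D≢C′) (≢-sym Cy≢C′) D≢C
    by-cases (inj₁ (A , A∈ , A≢C)) (inj₁ (B , B∈ , B≢C)) with A ≟ˢ B
    ... | no A≢B = triple C∈ A∈ B∈ (≢-sym A≢C) (≢-sym B≢C) A≢B
    -- `x` and `y` collide on `A`; one of them has a block other than `C` and `A` and switches to
    -- it.
    ... | yes refl with escape (member C∈) (member A∈)
    ... | D , inj₁ D∈ , D≢C , D≢A = triple C∈ D∈ B∈ (≢-sym D≢C) (≢-sym B≢C) D≢A
    ... | D , inj₂ D∈ , D≢C , D≢A = triple C∈ A∈ D∈ (≢-sym A≢C) (≢-sym D≢C) (≢-sym D≢A)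

  -- If some pair of members contains the blocks of `x` and `y`, then `pair-span` is a flat and `z`
  -- is forced into it. If none does, `transversal₃` makes {x, y} a flat that misses `z`.
  collinear⇒within : ∀ {x y z} → x ≢ y → z ≢ x → z ≢ y →
    (∀ (X : Flat) → x Subset.∈ proj₁ X → y Subset.∈ proj₁ X → z Subset.∈ proj₁ X) →
    ∃[ A ] ∃[ B ] Within A B x × Within A B y × Within A B z
  collinear⇒within {x} {y} {z} x≢y z≢x z≢y collinear
    with Any.any? (λ A → Any.any? (λ B → within? A B x ×-dec within? A B y) members) members
  ... | yes p with A , _ , pA ← find p with B , _ , x-in , y-in ← find pA =
    A , B , x-in , y-in , ∈-tabulate⁻ (within? A B)
      (collinear (pair-span-flat x≢y x-in y-in) (∈-tabulate⁺ (within? A B) x-in) (∈-tabulate⁺ (within? A B) y-in))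
  ... | no ¬p = ⊥-elim (z∉ (∈-setOf⁻ _ (collinear line
    (∈-setOf⁺ {xs = x ∷ y ∷ []} here₀) (∈-setOf⁺ {xs = x ∷ y ∷ []} here₁))))
    where
    z∉ : z ∉ x ∷ y ∷ []
    z∉ here₀ = z≢x refl
    z∉ here₁ = z≢y refl

    line : Flat
    line = setOf (x ∷ y ∷ []) , transversal-flat (proj₂ (proj₂ (transversal₂ x≢y))) λ w w∉ →
      let (_ , _ , _ , t) = transversal₃ x≢y (λ { refl → w∉ here₀ }) (λ { refl → w∉ here₁ })
                              (λ A∈ B∈ w → ¬p (lose A∈ (lose B∈ w)))
      in _ , t , refl

  -- Elements whose blocks are a whole pair.

  Full : Subset m → Subset m → Fin m → Set
  Full A B x = A ∈ at 𝒞 x × B ∈ at 𝒞 x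

  reps-within : ∀ {A B x y} → x ≢ y → Within A B x → Within A B y →
    A ≢ B × ((A ∈ at 𝒞 x × B ∈ at 𝒞 y) ⊎ (B ∈ at 𝒞 x × A ∈ at 𝒞 y))
  reps-within x≢y x-in y-in with C , D , C∈ , D∈ , C≢D ← distinct-reps x≢y with x-in C∈ | y-in D∈
  ... | here₀ | here₀ = ⊥-elim (C≢D refl)
  ... | here₀ | here₁ = C≢D , inj₁ (C∈ , D∈)
  ... | here₁ | here₀ = ≢-sym C≢D , inj₂ (C∈ , D∈)
  ... | here₁ | here₁ = ⊥-elim (C≢D refl)

  -- Each two of the three elements can be matched to `A` and `B`. If every element used the same
  -- block in both of its matchings, this would properly 2-colour a triangle; so some element uses
  -- both blocks.
  some-full : ∀ {A B x y z} → x ≢ y → z ≢ x → z ≢ y → Within A B x → Within A B y → Within A B z →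
              Full A B x ⊎ Full A B y ⊎ Full A B z
  some-full x≢y z≢x z≢y x-in y-in z-in
    with reps-within x≢y x-in y-in | reps-within z≢x z-in x-in | reps-within z≢y z-in y-in
  ... | _ , inj₁ (Ax , By) | _ , inj₁ (Az , Bx) | _                  = inj₁ (Ax , Bx)
  ... | _ , inj₁ (Ax , By) | _ , inj₂ (Bz , Ax′) | _ , inj₁ (Az , _) = inj₂ (inj₂ (Az , Bz))
  ... | _ , inj₁ (Ax , By) | _ , inj₂ (Bz , Ax′) | _ , inj₂ (_ , Ay) = inj₂ (inj₁ (Ay , By))
  ... | _ , inj₂ (Bx , Ay) | _ , inj₂ (Bz , Ax) | _                  = inj₁ (Ax , Bx)
  ... | _ , inj₂ (Bx , Ay) | _ , inj₁ (Az , Bx′) | _ , inj₂ (Bz , _) = inj₂ (inj₂ (Az , Bz))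
  ... | _ , inj₂ (Bx , Ay) | _ , inj₁ (Az , Bx′) | _ , inj₁ (_ , By) = inj₂ (inj₁ (Ay , By))

  -- The distinct blocks `A` and `B` of `x` both occur among `A′` and `B′`, so the two pairs
  -- coincide. This is how one line through a full point passes its pair on to all the others.
  full-within : ∀ {A B A′ B′ x z} → A ≢ B → Full A B x → Within A′ B′ x → Within A′ B′ z → Within A B z
  full-within A≢B (A∈ , B∈) x-in z-in with x-in A∈ | x-in B∈
  ... | here₀ | here₀ = ⊥-elim (A≢B refl)
  ... | here₀ | here₁ = z-in
  ... | here₁ | here₀ = (λ { here₀ → here₁ ; here₁ → here₀ }) ∘ z-in
  ... | here₁ | here₁ = ⊥-elim (A≢B refl)

  full-length : ∀ {A B x} → A ≢ B → Within A B x → Full A B x → length (at 𝒞 x) ≡ 2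
  full-length {A} {B} {x} A≢B x-in (A∈ , B∈) = ℕₚ.≤-antisym (unique-⊆-length (at-unique x) x-in)
    (unique-⊆-length ((A≢B ∷ []) ∷ [] ∷ []) λ { here₀ → A∈ ; here₁ → B∈ })

  length-full : ∀ {A B x} → Within A B x → length (at 𝒞 x) ≡ 2 → Full A B x
  length-full {A} {B} {x} x-in len = has A B x-in , has B A ((λ { here₀ → here₁ ; here₁ → here₀ }) ∘ x-in)
    where
    has : ∀ A B → Within A B x → A ∈ at 𝒞 x
    has A B x-in with A ∈? at 𝒞 x
    ... | yes A∈ = A∈
    ... | no  A∉ = contradiction (subst (_≤ 1) len (unique-⊆-length {ys = B ∷ []} (at-unique x) only-B)) λ { (s≤s ()) }
      where
      only-B : ∀ {C} → C ∈ at 𝒞 x → C ∈ B ∷ []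
      only-B C∈ with x-in C∈
      ... | here₀ = ⊥-elim (A∉ C∈)
      ... | here₁ = here₀

  -- An element with two blocks has exactly `A` and `B`, which contain all blocks of every element.
  -- The full element `x` is there to make `ℰ` non-empty.
  ∣ℰ∣≡1 : ∀ {A B x} → A ≢ B → (∀ z → Within A B z) → Full A B x → length (ℰ 𝒞) ≡ 1
  ∣ℰ∣≡1 {A} {B} {x} A≢B all-in full = deduplicate-constant _≟ˢ_ _ constant
    (Mem.∈-map⁺ (E 𝒞) (Mem.∈-filter⁺ size? (Mem.∈-allFin x) (full-length A≢B (all-in x) full)))
    where
    size? : ∀ x → Dec (length (at 𝒞 x) ≡ 2)
    size? x = length (at 𝒞 x) ℕ.≟ 2

    constant : ∀ {S} → S ∈ map (E 𝒞) (filter size? (allFin m)) → S ≡ Subset.⊤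
    constant S∈ with z , z∈ , refl ← Mem.∈-map⁻ (E 𝒞) S∈
      with A∈ , B∈ ← length-full (all-in z) (proj₂ (Mem.∈-filter⁻ size? {xs = allFin m} z∈)) =
      Subsetₚ.⊆-antisym Subsetₚ.⊆⊤ λ {y} _ → ∈-tabulate⁺ (λ y → at 𝒞 y ⊆ᶜ? at 𝒞 z)
        ((λ { here₀ → A∈ ; here₁ → B∈ }) ∘ all-in y)

-- Decidable arithmetic in a finite field.

module FiniteField {c ℓ₁ ℓ₂} (F : HeytingField c ℓ₁ ℓ₂) {q} (ord : HasOrder F q) where
  open HeytingField F using (_#_; tight; #⇒invertible; #-irrefl)
  open HeytingCommutativeRingₚ (HeytingField.heytingCommutativeRing F) using (1#0; x-0≈x)
  open CommutativeRing (fieldRing F) renaming (refl to ≈-refl; sym to ≈-sym; trans to ≈-trans)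
  open Inverse ord public using () renaming (from to scalar; to to code)

  scalar-code : ∀ x → scalar (code x) ≈ x
  scalar-code = Inverse.strictlyInverseʳ ord

  scalar-injective : ∀ {i j} → scalar i ≈ scalar j → i ≡ j
  scalar-injective {i} {j} eq =
    trans (sym (Inverse.strictlyInverseˡ ord i)) (trans (Inverse.to-cong ord eq) (Inverse.strictlyInverseˡ ord j))

  _≈?_ : ∀ x y → Dec (x ≈ y)
  x ≈? y = map′ (λ eq → ≈-trans (≈-sym (scalar-code x)) (≈-trans (reflexive (cong scalar eq)) (scalar-code y)))
                (Inverse.to-cong ord) (code x Finₚ.≟ code y)

  1≉0 : ¬ 1# ≈ 0#
  1≉0 eq = #-irrefl eq 1#0

  -- Non-equality alone does not give apartness, so an inverse is searched for among all q scalars.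
  -- If there is none, `x` is not apart from 0, and tightness gives `x ≈ 0#`.
  inverse : ∀ {x} → ¬ x ≈ 0# → ∃[ y ] y * x ≈ 1#
  inverse {x} x≉0 with Finₚ.any? (λ i → (scalar i * x) ≈? 1#)
  ... | yes (i , eq) = scalar i , eq
  ... | no ¬inv = ⊥-elim (x≉0 (proj₁ (tight x 0#) λ x#0 →
    let (y , yx≈1 , _) = #⇒invertible x#0 in
    ¬inv (code y , ≈-trans (*-cong (scalar-code y) (≈-sym (x-0≈x x))) yx≈1)))

-- Coordinates and spans in V.

module FiniteVectorSpace {c ℓ₁ ℓ₂ v ℓv} (F : HeytingField c ℓ₁ ℓ₂) {q} (ord : HasOrder F q)
  (V : VectorSpace F v ℓv) {n} (b : Vector (Module.Carrierᴹ V) n) (basis : IsBasis {F = F} V b) where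

  open FiniteField F ord public
  open CommutativeRing (fieldRing F) public hiding (zero)
    renaming (_+_ to _⊕_; refl to ≈-refl; sym to ≈-sym; trans to ≈-trans)
  open Module V public hiding (isModule)
  open IsBasis basis

  vec : Vector Carrier n → Carrierᴹ
  vec a = combination {F = F} V a b

  combination-cong : ∀ {k} {a a′ : Vector Carrier k} (d : Vector Carrierᴹ k) → (∀ i → a i ≈ a′ i) →
                     combination {F = F} V a d ≈ᴹ combination {F = F} V a′ d
  combination-cong d eq = Sumₚ.sum-cong-≋ +ᴹ-commutativeMonoid (λ i → *ₗ-cong (eq i) ≈ᴹ-refl)

  combination-+ : ∀ {k} (a a′ : Vector Carrier k) (d : Vector Carrierᴹ k) →
    combination {F = F} V (λ i → a i ⊕ a′ i) d ≈ᴹ combination {F = F} V a d +ᴹ combination {F = F} V a′ d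
  combination-+ a a′ d = ≈ᴹ-trans
    (Sumₚ.sum-cong-≋ +ᴹ-commutativeMonoid (λ i → *ₗ-distribʳ (d i) (a i) (a′ i)))
    (Sumₚ.∑-distrib-+ +ᴹ-commutativeMonoid (λ i → a i *ₗ d i) (λ i → a′ i *ₗ d i))

  combination-* : ∀ {k} r (a : Vector Carrier k) (d : Vector Carrierᴹ k) →
    combination {F = F} V (λ i → r * a i) d ≈ᴹ r *ₗ combination {F = F} V a d
  combination-* {ℕ.zero}  r a d = ≈ᴹ-sym (*ₗ-zeroʳ r)
  combination-* {ℕ.suc k} r a d = ≈ᴹ-trans
    (+ᴹ-cong (*ₗ-assoc r (a zero) (d zero)) (combination-* r (a ∘ suc) (d ∘ suc)))
    (≈ᴹ-sym (*ₗ-distribˡ r _ _))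

  vec-cong : ∀ {a a′} → (∀ i → a i ≈ a′ i) → vec a ≈ᴹ vec a′
  vec-cong = combination-cong b

  -1*x : ∀ u → (- 1#) *ₗ u ≈ᴹ -ᴹ u
  -1*x u = Groupₚ.inverseʳ-unique +ᴹ-group u _ (begin
    u +ᴹ (- 1#) *ₗ u           ≈⟨ +ᴹ-congʳ (*ₗ-identityˡ u) ⟨
    1# *ₗ u +ᴹ (- 1#) *ₗ u     ≈⟨ *ₗ-distribʳ u 1# (- 1#) ⟨
    (1# ⊕ - 1#) *ₗ u           ≈⟨ *ₗ-cong (-‿inverseʳ 1#) ≈ᴹ-refl ⟩
    0# *ₗ u                    ≈⟨ *ₗ-zeroˡ u ⟩
    0ᴹ                         ∎)
    where open ≈-Reasoning ≈ᴹ-setoid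

  vec-injective : ∀ {a a′} → vec a ≈ᴹ vec a′ → ∀ i → a i ≈ a′ i
  vec-injective {a} {a′} eq i = Groupₚ.x∙y⁻¹≈ε⇒x≈y +-group (a i) (a′ i)
    (≈-trans (+-congˡ (≈-sym (Ringₚ.-1*x≈-x ring (a′ i)))) (independent _ difference i))
    where
    open ≈-Reasoning ≈ᴹ-setoid

    -- Subtraction is written with the scalar -1 so that linearity of `combination` applies.
    difference : vec (λ j → a j ⊕ (- 1#) * a′ j) ≈ᴹ 0ᴹ
    difference = begin
      vec (λ j → a j ⊕ (- 1#) * a′ j)      ≈⟨ combination-+ a _ b ⟩
      vec a +ᴹ vec (λ j → (- 1#) * a′ j)   ≈⟨ +ᴹ-congˡ (combination-* (- 1#) a′ b) ⟩
      vec a +ᴹ (- 1#) *ₗ vec a′            ≈⟨ +ᴹ-congˡ (-1*x (vec a′)) ⟩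
      vec a +ᴹ -ᴹ vec a′                   ≈⟨ Groupₚ.x≈y⇒x∙y⁻¹≈ε +ᴹ-group eq ⟩
      0ᴹ                                   ∎

  coord : Carrierᴹ → Vector Carrier n
  coord u = proj₁ (spanning u)

  vec-coord : ∀ u → vec (coord u) ≈ᴹ u
  vec-coord u = proj₂ (spanning u)

  coord-cong : ∀ {u w} → u ≈ᴹ w → ∀ i → coord u i ≈ coord w i
  coord-cong {u} {w} eq = vec-injective (≈ᴹ-trans (vec-coord u) (≈ᴹ-trans eq (≈ᴹ-sym (vec-coord w))))

  coord-vec : ∀ a i → coord (vec a) i ≈ a i
  coord-vec a = vec-injective (vec-coord (vec a))

  coord-+ : ∀ u w i → coord (u +ᴹ w) i ≈ coord u i ⊕ coord w i
  coord-+ u w = vec-injective (≈ᴹ-trans (vec-coord _) (≈ᴹ-trans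
    (+ᴹ-cong (≈ᴹ-sym (vec-coord u)) (≈ᴹ-sym (vec-coord w))) (≈ᴹ-sym (combination-+ _ _ b))))

  coord-* : ∀ r u i → coord (r *ₗ u) i ≈ r * coord u i
  coord-* r u = vec-injective (≈ᴹ-trans (vec-coord _) (≈ᴹ-trans
    (*ₗ-cong ≈-refl (≈ᴹ-sym (vec-coord u))) (≈ᴹ-sym (combination-* _ _ b))))

  coord-0 : ∀ {u} → u ≈ᴹ 0ᴹ → ∀ i → coord u i ≈ 0#
  coord-0 {u} u≈0 = independent _ (≈ᴹ-trans (vec-coord u) u≈0)

  _≈ᴹ?_ : ∀ u w → Dec (u ≈ᴹ w)
  u ≈ᴹ? w = map′ (λ eq → ≈ᴹ-trans (≈ᴹ-sym (vec-coord u)) (≈ᴹ-trans (vec-cong eq) (vec-coord w)))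
                 coord-cong (Finₚ.all? (λ i → coord u i ≈? coord w i))

  -- With `u` and `w` equal this serves as the span of a single vector, so one construction yields
  -- both points and lines.
  _∈⟨_,_⟩ : Carrierᴹ → Carrierᴹ → Carrierᴹ → Set (c ⊔ ℓv)
  x ∈⟨ u , w ⟩ = ∃[ r ] ∃[ s ] r *ₗ u +ᴹ s *ₗ w ≈ᴹ x

  ∈⟨⟩? : ∀ u w x → Dec (x ∈⟨ u , w ⟩)
  ∈⟨⟩? u w x = map′ (λ (i , j , eq) → scalar i , scalar j , eq)
    (λ (r , s , eq) → code r , code s ,
      ≈ᴹ-trans (+ᴹ-cong (*ₗ-cong (scalar-code r) ≈ᴹ-refl) (*ₗ-cong (scalar-code s) ≈ᴹ-refl)) eq)
    (Finₚ.any? λ i → Finₚ.any? λ j → (scalar i *ₗ u +ᴹ scalar j *ₗ w) ≈ᴹ? x)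

  left∈⟨⟩ : ∀ u w → u ∈⟨ u , w ⟩
  left∈⟨⟩ u w = 1# , 0# , ≈ᴹ-trans (+ᴹ-cong (*ₗ-identityˡ u) (*ₗ-zeroˡ w)) (+ᴹ-identityʳ u)

  right∈⟨⟩ : ∀ u w → w ∈⟨ u , w ⟩
  right∈⟨⟩ u w = 0# , 1# , ≈ᴹ-trans (+ᴹ-cong (*ₗ-zeroˡ u) (*ₗ-identityˡ w)) (+ᴹ-identityˡ w)

  sum∈⟨⟩ : ∀ u w → (u +ᴹ w) ∈⟨ u , w ⟩
  sum∈⟨⟩ u w = 1# , 1# , +ᴹ-cong (*ₗ-identityˡ u) (*ₗ-identityˡ w)

  coord-combination : ∀ u w r s i → coord (r *ₗ u +ᴹ s *ₗ w) i ≈ r * coord u i ⊕ s * coord w i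
  coord-combination u w r s i = ≈-trans (coord-+ _ _ i) (+-cong (coord-* r u i) (coord-* s w i))

  -- Used in the contrapositive: a single coordinate certifies that a vector is outside a span, and
  -- all independence arguments below rest on this.
  coord-∈⟨⟩ : ∀ {u w x} i → coord u i ≈ 0# → coord w i ≈ 0# → x ∈⟨ u , w ⟩ → coord x i ≈ 0#
  coord-∈⟨⟩ {u} {w} {x} i u≈0 w≈0 (r , s , eq) = begin
    coord x i                            ≈⟨ coord-cong eq i ⟨
    coord (r *ₗ u +ᴹ s *ₗ w) i           ≈⟨ coord-combination u w r s i ⟩
    r * coord u i ⊕ s * coord w i        ≈⟨ +-cong (≈-trans (*-congˡ u≈0) (zeroʳ r)) (≈-trans (*-congˡ w≈0) (zeroʳ s)) ⟩
    0# ⊕ 0#                              ≈⟨ +-identityˡ 0# ⟩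
    0#                                   ∎
    where open ≈-Reasoning setoid

  module _ {p : Level} where
    open Subspace
    open CommutativeSemigroupₚ (CommutativeMonoid.commutativeSemigroup +ᴹ-commutativeMonoid) using (interchange)

    -- Membership is decided first, so that the carrier can live at any level p.
    span : Carrierᴹ → Carrierᴹ → Subspace {F = F} V p
    span u w = record
      { carrier   = λ x → Lift p (True (∈⟨⟩? u w x))
      ; decidable = λ x → map′ (lift ∘ fromWitness) (toWitness ∘ lower) (∈⟨⟩? u w x)
      ; resp      = λ x≈y x∈ → let (r , s , eq) = toWitness (lower x∈) in
                      lift (fromWitness (r , s , ≈ᴹ-trans eq x≈y))
      ; 0-closed  = lift (fromWitness (0# , 0# ,
                      ≈ᴹ-trans (+ᴹ-cong (*ₗ-zeroˡ u) (*ₗ-zeroˡ w)) (+ᴹ-identityˡ 0ᴹ)))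
      ; +-closed  = λ x∈ y∈ → let (r , s , eq) = toWitness (lower x∈) ; (r′ , s′ , eq′) = toWitness (lower y∈) in
                      lift (fromWitness (r ⊕ r′ , s ⊕ s′ , ≈ᴹ-trans
                        (≈ᴹ-trans (+ᴹ-cong (*ₗ-distribʳ u r r′) (*ₗ-distribʳ w s s′))
                                  (interchange _ _ _ _))
                        (+ᴹ-cong eq eq′)))
      ; *-closed  = λ a x∈ → let (r , s , eq) = toWitness (lower x∈) in
                      lift (fromWitness (a * r , a * s , ≈ᴹ-trans
                        (≈ᴹ-trans (+ᴹ-cong (*ₗ-assoc a r u) (*ₗ-assoc a s w)) (≈ᴹ-sym (*ₗ-distribˡ a _ _)))
                        (*ₗ-cong ≈-refl eq)))
      }

    ∈span⁺ : ∀ {u w x} → x ∈⟨ u , w ⟩ → carrier (span u w) x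
    ∈span⁺ = lift ∘ fromWitness

    ∈span⁻ : ∀ {u w x} → carrier (span u w) x → x ∈⟨ u , w ⟩
    ∈span⁻ = toWitness ∘ lower

    span-⊆ : ∀ (S : Subspace {F = F} V p) {u w} → carrier S u → carrier S w → ∀ {x} → x ∈⟨ u , w ⟩ → carrier S x
    span-⊆ S u∈ w∈ (r , s , eq) = resp S eq (+-closed S (*-closed S r u∈) (*-closed S s w∈))

    -- Here `x` is `r ⊕ s` times `u`, and this factor is invertible because `x` is not zero.
    span-nonzero : ∀ (S : Subspace {F = F} V p) {u x} → x ∈⟨ u , u ⟩ → ¬ x ≈ᴹ 0ᴹ → carrier S x → carrier S u
    span-nonzero S {u} {x} (r , s , eq) x≉0 x∈ with (r ⊕ s) ≈? 0#
    ... | yes r+s≈0 = ⊥-elim (x≉0 (begin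
      x                    ≈⟨ eq ⟨
      r *ₗ u +ᴹ s *ₗ u     ≈⟨ *ₗ-distribʳ u r s ⟨
      (r ⊕ s) *ₗ u         ≈⟨ *ₗ-cong r+s≈0 ≈ᴹ-refl ⟩
      0# *ₗ u              ≈⟨ *ₗ-zeroˡ u ⟩
      0ᴹ                   ∎))
      where open ≈-Reasoning ≈ᴹ-setoid
    ... | no r+s≉0 with t , t*[r+s]≈1 ← inverse r+s≉0 = resp S (begin
      t *ₗ x                     ≈⟨ *ₗ-cong ≈-refl eq ⟨
      t *ₗ (r *ₗ u +ᴹ s *ₗ u)    ≈⟨ *ₗ-cong ≈-refl (*ₗ-distribʳ u r s) ⟨
      t *ₗ (r ⊕ s) *ₗ u          ≈⟨ *ₗ-assoc t (r ⊕ s) u ⟨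
      (t * (r ⊕ s)) *ₗ u         ≈⟨ *ₗ-cong t*[r+s]≈1 ≈ᴹ-refl ⟩
      1# *ₗ u                    ≈⟨ *ₗ-identityˡ u ⟩
      u                          ∎) (*-closed S t x∈)
      where open ≈-Reasoning ≈ᴹ-setoid

-- Vectors of V and the elements of U that represent them.

module Correspondence {c ℓ₁ ℓ₂ v ℓv p : Level} {m : ℕ} (𝒞 : Covering m)
  (simple : ¬ (∃[ x ] ∃[ y ] x ≢ y × SameAt 𝒞 x y × length (at 𝒞 x) ≡ 1))
  (F : HeytingField c ℓ₁ ℓ₂) {q : ℕ} (ord : HasOrder F q) (V : VectorSpace F v ℓv)
  {n : ℕ} (b : Vector (Module.Carrierᴹ V) n) (basis : IsBasis {F = F} V b)
  (iso : L 𝒞 ≅ SubspaceLattice {F = F} V p) where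

  open TransversalMatroid 𝒞
  open SimpleCovering 𝒞 simple
  open FiniteVectorSpace F ord V b basis
  open Subspace

  image : Flat → Subspace {F = F} V p
  image = proj₁ iso

  open IsOrderIsomorphism (proj₂ iso) using (mono; cancel; surjective)

  image-mono : ∀ X Y → proj₁ X Subset.⊆ proj₁ Y → ∀ {u} → carrier (image X) u → carrier (image Y) u
  image-mono X Y X⊆Y = mono {X} {Y} X⊆Y

  image-cancel : ∀ X Y → (∀ {u} → carrier (image X) u → carrier (image Y) u) → proj₁ X Subset.⊆ proj₁ Y
  image-cancel X Y sub = cancel {X} {Y} sub

  preimage : Subspace {F = F} V p → Flat
  preimage S = proj₁ (surjective S)

  preimage⁺ : ∀ S {u} → carrier S u → carrier (image (preimage S)) u
  preimage⁺ S = proj₂ (proj₂ (surjective S) {preimage S} refl)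

  preimage⁻ : ∀ S {u} → carrier (image (preimage S)) u → carrier S u
  preimage⁻ S = proj₁ (proj₂ (surjective S) {preimage S} refl)

  point-⊆ : ∀ {x} (X : Flat) → x Subset.∈ proj₁ X → proj₁ (point-flat x) Subset.⊆ proj₁ X
  point-⊆ X x∈ {y} y∈ with here₀ ← ∈-setOf⁻ (_ ∷ []) y∈ = x∈

  x∈point : ∀ x → x Subset.∈ proj₁ (point-flat x)
  x∈point x = ∈-setOf⁺ {xs = x ∷ []} here₀

  -- A zero image would lie in the image of the empty flat, and reflecting the order would put `x`
  -- into the empty set.
  point-image-nonzero : ∀ x → ¬ (∀ {u} → carrier (image (point-flat x)) u → u ≈ᴹ 0ᴹ)
  point-image-nonzero x zero-only = Subsetₚ.∉⊥ (image-cancel (point-flat x) empty-flat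
    (λ u∈ → resp (image empty-flat) (≈ᴹ-sym (zero-only u∈)) (0-closed (image empty-flat))) (x∈point x))

  -- Says that the flat {x} corresponds to the subspace spanned by `u`, in a form that moves
  -- membership directly between flats and their images.
  Represents : Carrierᴹ → Fin m → Set p
  Represents u x = ∀ X → x Subset.∈ proj₁ X ⇔ carrier (image X) u

  abstract
    -- Any element of the flat that corresponds to the span of `u` will do. Were this flat empty, it
    -- would lie in the flat of the zero subspace and `u` would be 0.
    represents : ∀ u i → ¬ coord u i ≈ 0# → ∃[ x ] Represents u x
    represents u i uᵢ≉0 with Subsetₚ.nonempty? (proj₁ (preimage (span u u)))
    ... | no empty = ⊥-elim (uᵢ≉0 (coord-∈⟨⟩ i (coord-0 ≈ᴹ-refl i) (coord-0 ≈ᴹ-refl i)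
        (∈span⁻ (preimage⁻ (span 0ᴹ 0ᴹ) (image-mono P (preimage (span 0ᴹ 0ᴹ)) (λ x∈ → ⊥-elim (empty (_ , x∈)))
          (preimage⁺ (span u u) (∈span⁺ (left∈⟨⟩ u u))))))))
      where
      P : Flat
      P = preimage (span u u)
    ... | yes (x , x∈P) = x , λ X → mk⇔ (to X) (from X)
      where
      P : Flat
      P = preimage (span u u)

      to : ∀ X → x Subset.∈ proj₁ X → carrier (image X) u
      to X x∈X with decidable (image (point-flat x)) u
      -- The image of {x} consists of multiples of `u`. Either it contains `u`, or it contains no
      -- non-zero vector, which is impossible.
      ... | yes u∈ = image-mono (point-flat x) X (point-⊆ X x∈X) u∈
      ... | no u∉ = ⊥-elim (point-image-nonzero x zero-only)
        where
        zero-only : ∀ {w} → carrier (image (point-flat x)) w → w ≈ᴹ 0ᴹ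
        zero-only {w} w∈ with w ≈ᴹ? 0ᴹ
        ... | yes eq = eq
        ... | no w≉0 = ⊥-elim (u∉ (span-nonzero (image (point-flat x))
          (∈span⁻ (preimage⁻ (span u u) (image-mono (point-flat x) P (point-⊆ P x∈P) w∈))) w≉0 w∈))

      from : ∀ X → carrier (image X) u → x Subset.∈ proj₁ X
      from X u∈X = image-cancel P X (λ w∈ → span-⊆ (image X) u∈X u∈X (∈span⁻ (preimage⁻ (span u u) w∈))) x∈P

  represents-∈⟨⟩ : ∀ {u w x} → Represents u x → Represents w x → w ∈⟨ u , u ⟩
  represents-∈⟨⟩ {u} ux wx = ∈span⁻ (preimage⁻ (span u u) (Equivalence.to (wx P) (Equivalence.from (ux P)
    (preimage⁺ (span u u) (∈span⁺ (left∈⟨⟩ u u))))))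
    where P = preimage (span u u)

  represents-distinct : ∀ {u w x y} i → Represents u x → Represents w y →
                        coord u i ≈ 0# → ¬ coord w i ≈ 0# → x ≢ y
  represents-distinct i ux wy u≈0 w≉0 refl = w≉0 (coord-∈⟨⟩ i u≈0 u≈0 (represents-∈⟨⟩ ux wy))

  collinear : ∀ {u w t x y z} → Represents u x → Represents w y → Represents t z → t ∈⟨ u , w ⟩ →
    ∀ X → x Subset.∈ proj₁ X → y Subset.∈ proj₁ X → z Subset.∈ proj₁ X
  collinear ux wy tz t∈ X x∈ y∈ = Equivalence.from (tz X)
    (span-⊆ (image X) (Equivalence.to (ux X) x∈) (Equivalence.to (wy X) y∈) t∈)

  ≈1⇒≉0 : ∀ {r} → r ≈ 1# → ¬ r ≈ 0#
  ≈1⇒≉0 r≈1 r≈0 = 1≉0 (≈-trans (≈-sym r≈1) r≈0)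

  -- The vector of the full point is kept abstract as `τ`, since it may be `u`, `w` or their sum;
  -- `τ≉0` is all that is remembered of its coordinates.
  record FullLine (u w : Carrierᴹ) (i j : Fin n) : Set (c ⊔ ℓ₁ ⊔ v ⊔ ℓv ⊔ p) where
    field
      {x y t}         : Fin m
      {A B}           : Subset m
      {τ}             : Carrierᴹ
      x-rep           : Represents u x
      y-rep           : Represents w y
      x≢y             : x ≢ y
      A≢B             : A ≢ B
      x-in            : Within A B x
      y-in            : Within A B y
      t-rep           : Represents τ t
      t-full          : Full A B t
      t-in            : Within A B t
      τ∈              : τ ∈⟨ u , w ⟩
      τ≉0             : ¬ coord τ i ≈ 0# ⊎ ¬ coord τ j ≈ 0#

    flat : Flat
    flat = pair-span-flat x≢y x-in y-in

    ⟨u,w⟩⊆flat : ∀ {s} → s ∈⟨ u , w ⟩ → carrier (image flat) s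
    ⟨u,w⟩⊆flat = span-⊆ (image flat) (Equivalence.to (x-rep flat) (∈-tabulate⁺ (within? A B) x-in))
                                     (Equivalence.to (y-rep flat) (∈-tabulate⁺ (within? A B) y-in))

  abstract
    -- The third point of the line is that of `u +ᴹ w`; coordinates `i` and `j` tell the three
    -- points apart.
    full-line : ∀ {u w} i j → coord u i ≈ 1# → coord u j ≈ 0# → coord w i ≈ 0# → coord w j ≈ 1# →
                FullLine u w i j
    full-line {u} {w} i j uᵢ uⱼ wᵢ wⱼ
      with x , x-rep ← represents u i (≈1⇒≉0 uᵢ)
         | y , y-rep ← represents w j (≈1⇒≉0 wⱼ)
      with sᵢ ← ≈-trans (coord-+ u w i) (≈-trans (+-cong uᵢ wᵢ) (+-identityʳ 1#))
         | sⱼ ← ≈-trans (coord-+ u w j) (≈-trans (+-cong uⱼ wⱼ) (+-identityˡ 1#))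
      with z , z-rep ← represents (u +ᴹ w) i (≈1⇒≉0 sᵢ)
      with x≢y ← represents-distinct j x-rep y-rep uⱼ (≈1⇒≉0 wⱼ)
         | z≢x ← ≢-sym (represents-distinct j x-rep z-rep uⱼ (≈1⇒≉0 sⱼ))
         | z≢y ← ≢-sym (represents-distinct i y-rep z-rep wᵢ (≈1⇒≉0 sᵢ))
      with A , B , x-in , y-in , z-in ← collinear⇒within x≢y z≢x z≢y (collinear x-rep y-rep z-rep (sum∈⟨⟩ u w))
      with A≢B , _ ← reps-within x≢y x-in y-in
      with some-full x≢y z≢x z≢y x-in y-in z-in
    ... | full = line-of full
      where
      line : ∀ {τ t} → Represents τ t → Full A B t → Within A B t → τ ∈⟨ u , w ⟩ →
             ¬ coord τ i ≈ 0# ⊎ ¬ coord τ j ≈ 0# → FullLine u w i j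
      line t-rep t-full t-in τ∈ τ≉0 = record
        { x-rep = x-rep ; y-rep = y-rep ; x≢y = x≢y ; A≢B = A≢B ; x-in = x-in ; y-in = y-in
        ; t-rep = t-rep ; t-full = t-full ; t-in = t-in ; τ∈ = τ∈ ; τ≉0 = τ≉0 }

      line-of : Full A B x ⊎ Full A B y ⊎ Full A B z → FullLine u w i j
      line-of (inj₁ full)        = line x-rep full x-in (left∈⟨⟩ u w) (inj₁ (≈1⇒≉0 uᵢ))
      line-of (inj₂ (inj₁ full)) = line y-rep full y-in (right∈⟨⟩ u w) (inj₂ (≈1⇒≉0 wⱼ))
      line-of (inj₂ (inj₂ full)) = line z-rep full z-in (sum∈⟨⟩ u w) (inj₁ (≈1⇒≉0 sᵢ))

  -- Every line through the full point t lies in the two blocks at t, so these would contain the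
  -- blocks of the independent points u, w and s.
  no-third-direction : ∀ {u w s i j} k → FullLine u w i j → coord u k ≈ 0# → coord w k ≈ 0# →
    coord s i ≈ 0# → coord s j ≈ 0# → coord s k ≈ 1# → ⊥
  no-third-direction {u} {w} {s} {i} {j} k line uₖ wₖ sᵢ sⱼ sₖ with represents s k (≈1⇒≉0 sₖ)
  ... | z , z-rep = ≈1⇒≉0 sₖ (coord-∈⟨⟩ k uₖ wₖ
                      (∈span⁻ (preimage⁻ (span u w) (Equivalence.to (z-rep Y) z∈Y))))
    where
    open FullLine line
    Y = preimage (span u w)

    τₖ : coord τ k ≈ 0#
    τₖ = coord-∈⟨⟩ k uₖ wₖ τ∈

    τ+sₖ : ¬ coord (τ +ᴹ s) k ≈ 0#
    τ+sₖ = ≈1⇒≉0 (≈-trans (coord-+ τ s k) (≈-trans (+-cong τₖ sₖ) (+-identityˡ 1#)))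

    -- Where `s` vanishes, `τ +ᴹ s` has the coordinate of `τ`; by `τ≉0` it is non-zero at `i` or at
    -- `j`.
    off : ∀ {l y} → coord s l ≈ 0# → ¬ coord τ l ≈ 0# → Represents (τ +ᴹ s) y → z ≢ y
    off {l} sₗ τₗ y-rep = represents-distinct l z-rep y-rep sₗ
      (τₗ ∘ ≈-trans (≈-sym (≈-trans (coord-+ τ s l) (≈-trans (+-congˡ sₗ) (+-identityʳ _)))))

    distinct : ∀ {y} → Represents (τ +ᴹ s) y → z ≢ y
    distinct = [ off sᵢ , off sⱼ ]′ τ≉0

    z-in : Within A B z
    -- The line through `t` and `z` has the third point `y`, so some pair contains its blocks;
    -- fullness of `t` identifies that pair with `A`, `B`.
    z-in with y , y-rep ← represents (τ +ᴹ s) k τ+sₖ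
      with _ , _ , t-in′ , z-in′ , _ ← collinear⇒within
             (represents-distinct k t-rep z-rep τₖ (≈1⇒≉0 sₖ))
             (≢-sym (represents-distinct k t-rep y-rep τₖ τ+sₖ)) (≢-sym (distinct y-rep))
             (collinear t-rep z-rep y-rep (sum∈⟨⟩ τ s))
      = full-within A≢B t-full t-in′ z-in′

    Y⊆flat : proj₁ Y Subset.⊆ proj₁ flat
    Y⊆flat = image-cancel Y flat (⟨u,w⟩⊆flat ∘ ∈span⁻ ∘ preimage⁻ (span u w))

    z∈Y : z Subset.∈ proj₁ Y
    -- `flat` is only known to contain the line `Y`. But `Y` already has rank 2 and its blocks are
    -- in the pair, so it absorbs every element of the pair.
    z∈Y = in-rank₂-flat Y x≢y (λ y∈ → ∈-tabulate⁻ (within? A B) (Y⊆flat y∈))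
      (Equivalence.from (x-rep Y) (preimage⁺ (span u w) (∈span⁺ (left∈⟨⟩ u w))))
      (Equivalence.from (y-rep Y) (preimage⁺ (span u w) (∈span⁺ (right∈⟨⟩ u w)))) z-in

  unit : Fin n → Vector Carrier n
  unit i j = if does (i Finₚ.≟ j) then 1# else 0#

  axis : Fin n → Carrierᴹ
  axis i = vec (unit i)

  coord-axis : ∀ i j → coord (axis i) j ≈ unit i j
  coord-axis i = coord-vec (unit i)

-- The bound on n, from three coordinate axes.

dimension-≤2 : ∀ {c ℓ₁ ℓ₂ v ℓv p : Level} {m : ℕ} (𝒞 : Covering m) →
  ¬ (∃[ x ] ∃[ y ] x ≢ y × SameAt 𝒞 x y × length (at 𝒞 x) ≡ 1) →
  (F : HeytingField c ℓ₁ ℓ₂) {q : ℕ} → HasOrder F q →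
  (V : VectorSpace F v ℓv) {n : ℕ} → HasDimension {F = F} V n →
  L 𝒞 ≅ SubspaceLattice {F = F} V p → n ≤ 2
dimension-≤2 𝒞 simple F ord V {0} _ _ = z≤n
dimension-≤2 𝒞 simple F ord V {1} _ _ = s≤s z≤n
dimension-≤2 𝒞 simple F ord V {2} _ _ = s≤s (s≤s z≤n)
dimension-≤2 𝒞 simple F ord V {suc (suc (suc k))} (b , basis) iso = ⊥-elim
  (no-third-direction i₂ (full-line i₀ i₁ (coord-axis i₀ i₀) (coord-axis i₀ i₁) (coord-axis i₁ i₀) (coord-axis i₁ i₁))
    (coord-axis i₀ i₂) (coord-axis i₁ i₂) (coord-axis i₂ i₀) (coord-axis i₂ i₁) (coord-axis i₂ i₂))
  where
  open Correspondence 𝒞 simple F ord V b basis iso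
  i₀ i₁ i₂ : Fin (3 + k)
  i₀ = zero
  i₁ = suc zero
  i₂ = suc (suc zero)

-- The case n = 2: the projective line.

module Plane {c ℓ₁ ℓ₂ v ℓv p : Level} {m : ℕ} (𝒞 : Covering m)
  (simple : ¬ (∃[ x ] ∃[ y ] x ≢ y × SameAt 𝒞 x y × length (at 𝒞 x) ≡ 1))
  (F : HeytingField c ℓ₁ ℓ₂) {q : ℕ} (ord : HasOrder F q) (V : VectorSpace F v ℓv)
  (b : Vector (Module.Carrierᴹ V) 2) (basis : IsBasis {F = F} V b)
  (iso : L 𝒞 ≅ SubspaceLattice {F = F} V p) where

  open Correspondence 𝒞 simple F ord V b basis iso
  open TransversalMatroid 𝒞
  open SimpleCovering 𝒞 simple
  open FiniteVectorSpace F ord V b basis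
  open Subspace

  i₀ i₁ : Fin 2
  i₀ = zero
  i₁ = suc zero

  coord-ext : ∀ {u w} → coord u i₀ ≈ coord w i₀ → coord u i₁ ≈ coord w i₁ → u ≈ᴹ w
  coord-ext {u} {w} eq₀ eq₁ = ≈ᴹ-trans (≈ᴹ-sym (vec-coord u))
    (≈ᴹ-trans (vec-cong {coord u} {coord w} λ { zero → eq₀ ; (suc zero) → eq₁ }) (vec-coord w))

  axes-span : ∀ u → u ∈⟨ axis i₀ , axis i₁ ⟩
  axes-span u = coord u i₀ , coord u i₁ , coord-ext
    (≈-trans (coord-combination (axis i₀) (axis i₁) _ _ i₀) (≈-trans
      (+-cong (≈-trans (*-congˡ (coord-axis i₀ i₀)) (*-identityʳ _)) (≈-trans (*-congˡ (coord-axis i₁ i₀)) (zeroʳ _)))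
      (+-identityʳ _)))
    (≈-trans (coord-combination (axis i₀) (axis i₁) _ _ i₁) (≈-trans
      (+-cong (≈-trans (*-congˡ (coord-axis i₀ i₁)) (zeroʳ _)) (≈-trans (*-congˡ (coord-axis i₁ i₁)) (*-identityʳ _)))
      (+-identityˡ _)))

  ∣ℰ∣-plane : length (ℰ 𝒞) ≡ 1
  ∣ℰ∣-plane = ∣ℰ∣≡1 A≢B all-in t-full
    where
    open FullLine (full-line i₀ i₁ (coord-axis i₀ i₀) (coord-axis i₀ i₁) (coord-axis i₁ i₀) (coord-axis i₁ i₁))

    all-in : ∀ z → Within A B z
    -- The two axes span V, so the image of `flat` is everything and contains the image of {z}.
    all-in z = ∈-tabulate⁻ (within? A B)
      (image-cancel (point-flat z) flat (λ {u} _ → ⟨u,w⟩⊆flat (axes-span u)) (x∈point z))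

  -- Normalised homogeneous coordinates: the point (0 : 1) at infinity and the q points (1 : a),
  -- hence the count q + 1.
  homogeneous : Fin (suc q) → Vector Carrier 2
  homogeneous zero    = 0# Vector.∷ 1# Vector.∷ Vector.[]
  homogeneous (suc i) = 1# Vector.∷ scalar i Vector.∷ Vector.[]

  direction : Fin (suc q) → Carrierᴹ
  direction j = vec (homogeneous j)

  coord-direction : ∀ j i → coord (direction j) i ≈ homogeneous j i
  coord-direction j = coord-vec (homogeneous j)

  direction-represented : ∀ j → ∃[ x ] Represents (direction j) x
  direction-represented zero    = represents _ i₁ (≈1⇒≉0 (coord-direction zero i₁))
  direction-represented (suc i) = represents _ i₀ (≈1⇒≉0 (coord-direction (suc i) i₀))

  point : Fin (suc q) → Fin m
  point j = proj₁ (direction-represented j)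

  point-rep : ∀ j → Represents (direction j) (point j)
  point-rep j = proj₂ (direction-represented j)

  zero≢suc : ∀ i → point zero ≢ point (suc i)
  zero≢suc i = represents-distinct i₀ (point-rep zero) (point-rep (suc i))
    (coord-direction zero i₀) (≈1⇒≉0 (coord-direction (suc i) i₀))

  -- If (1, b) is a multiple of (1, a), comparing first coordinates shows that the factor `r ⊕ s` is
  -- 1, so a and b agree.
  point-injective : ∀ {j k} → point j ≡ point k → j ≡ k
  point-injective {zero}  {zero}  _  = refl
  point-injective {zero}  {suc k} eq = ⊥-elim (zero≢suc k eq)
  point-injective {suc j} {zero}  eq = ⊥-elim (zero≢suc j (sym eq))
  point-injective {suc j} {suc k} eq
    with r , s , r+s ← represents-∈⟨⟩ (point-rep (suc j)) (subst (Represents _) (sym eq) (point-rep (suc k)))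
    = cong suc (scalar-injective (begin
      scalar j                       ≈⟨ *-identityˡ _ ⟨
      1# * scalar j                  ≈⟨ *-congʳ (≈-trans (≈-sym (coord-direction (suc k) i₀))
                                            (≈-trans (coordinate i₀) (*-identityʳ _))) ⟩
      (r ⊕ s) * scalar j             ≈⟨ coordinate i₁ ⟨
      coord (direction (suc k)) i₁   ≈⟨ coord-direction (suc k) i₁ ⟩
      scalar k                       ∎))
    where
    open ≈-Reasoning setoid

    coordinate : ∀ i → coord (direction (suc k)) i ≈ (r ⊕ s) * homogeneous (suc j) i
    coordinate i = begin
      coord (direction (suc k)) i                                        ≈⟨ coord-cong r+s i ⟨
      coord (r *ₗ direction (suc j) +ᴹ s *ₗ direction (suc j)) i         ≈⟨ coord-combination _ _ r s i ⟩
      r * coord (direction (suc j)) i ⊕ s * coord (direction (suc j)) i  ≈⟨ distribʳ _ r s ⟨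
      (r ⊕ s) * coord (direction (suc j)) i                              ≈⟨ *-congˡ (coord-direction (suc j) i) ⟩
      (r ⊕ s) * homogeneous (suc j) i              ∎

  -- Divide `u` by its first non-zero coordinate.
  some-direction : ∀ (S : Subspace {F = F} V p) {u} → carrier S u → ¬ u ≈ᴹ 0ᴹ → ∃[ j ] carrier S (direction j)
  some-direction S {u} u∈ u≉0 with coord u i₀ ≈? 0#
  ... | no u₀≉0 with r , ru₀≈1 ← inverse u₀≉0 =
    let k = code (r * coord u i₁) in suc k , resp S (coord-ext
      (≈-trans (coord-* r u i₀) (≈-trans ru₀≈1 (≈-sym (coord-direction (suc k) i₀))))
      (≈-trans (coord-* r u i₁) (≈-trans (≈-sym (scalar-code _)) (≈-sym (coord-direction (suc k) i₁))))) (*-closed S r u∈)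
  ... | yes u₀≈0 with coord u i₁ ≈? 0#
  ... | yes u₁≈0 = ⊥-elim (u≉0 (coord-ext
    (≈-trans u₀≈0 (≈-sym (coord-0 ≈ᴹ-refl i₀)))
    (≈-trans u₁≈0 (≈-sym (coord-0 ≈ᴹ-refl i₁)))))
  ... | no u₁≉0 with r , ru₁≈1 ← inverse u₁≉0 =
    zero , resp S (coord-ext
      (≈-trans (coord-* r u i₀) (≈-trans (*-congˡ u₀≈0) (≈-trans (zeroʳ r) (≈-sym (coord-direction zero i₀)))))
      (≈-trans (coord-* r u i₁) (≈-trans ru₁≈1 (≈-sym (coord-direction zero i₁))))) (*-closed S r u∈)

  -- The image of {z} is not zero, so it contains a normalised direction, and the element
  -- representing that direction lies in {z}.
  point-surjective : ∀ z → ∃[ j ] point j ≡ z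
  point-surjective z with Finₚ.any? (λ j → decidable (image (point-flat z)) (direction j))
  ... | yes (j , d∈) with here₀ ← ∈-setOf⁻ (z ∷ []) (Equivalence.from (point-rep j (point-flat z)) d∈) = j , refl
  ... | no none = ⊥-elim (point-image-nonzero z zero-only)
    where
    zero-only : ∀ {u} → carrier (image (point-flat z)) u → u ≈ᴹ 0ᴹ
    zero-only {u} u∈ with u ≈ᴹ? 0ᴹ
    ... | yes u≈0 = u≈0
    ... | no  u≉0 = ⊥-elim (none (some-direction (image (point-flat z)) u∈ u≉0))

  size-plane : m ≡ suc q
  size-plane = Finₚ.cantor-schröder-bernstein {f = λ z → proj₁ (point-surjective z)} {g = point}
    (λ {y} {z} eq → trans (sym (proj₂ (point-surjective y)))
                      (trans (cong point eq) (proj₂ (point-surjective z))))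
    point-injective

theorem4p13 : ∀ {c ℓ₁ ℓ₂ v ℓv p : Level}
    (m : ℕ) (𝒞 : Covering m) →
    ¬ (∃[ x ] ∃[ y ] x ≢ y × SameAt 𝒞 x y × length (at 𝒞 x) ≡ 1) →
    (q : ℕ) (F : HeytingField c ℓ₁ ℓ₂) → HasOrder F q →
    (n : ℕ) (V : VectorSpace F v ℓv) → HasDimension {F = F} V n →
    L 𝒞 ≅ SubspaceLattice {F = F} V p →
    n ≤ 2 × (n ≡ 2 → m ≡ q + 1 × length (ℰ 𝒞) ≡ 1)
theorem4p13 m 𝒞 simple q F ord n V dim iso = dimension-≤2 𝒞 simple F ord V dim iso , plane dim
  where
  plane : HasDimension {F = F} V n → n ≡ 2 → m ≡ q + 1 × length (ℰ 𝒞) ≡ 1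
  plane (b , basis) refl = trans size-plane (ℕₚ.+-comm 1 q) , ∣ℰ∣-plane
    where open Plane 𝒞 simple F ord V b basis iso
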